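{- If $G$ is a primitive strongly regular graph, then the VC-dimension of $G$ is at least $2$.
   Context: All graphs are finite and simple. A graph $G$ on $v$ vertices is strongly regular, an $\mathrm{SRG}(v,k,\lambda,\mu)$, if every vertex has degree $k$, any two adjacent vertices have exactly $\lambda$ common neighbors, and any two distinct nonadjacent vertices have exactly $\mu$ common neighbors. $G$ is primitive if both $G$ and its complement $\overline G$ are connected (so the one-vertex graph is not considered). The VC-dimension of a graph $G$ is the maximum size of a set $S\subseteq V(G)$ that is shattered, meaning that for every $A\subseteq S$ there is a vertex $u\in V(G)$ (possibly $u\in S$) with $N(u)\cap S=A$, where $N(u)$ is the open neighborhood of $u$. -}

module Defs where

open import Data.Fin.Base using (Fin)
open import Data.Fin.Properties using (_≟_)
open import Data.Fin.Subset using (Subset; _⊆_; _∩_; ∣_∣)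
open import Data.Nat.Base using (ℕ; _≤_)
open import Data.Product.Base using (_×_; _,_; ∃-syntax)
open import Data.Vec.Base using (tabulate)
open import Function.Base using (_∘_)
open import Level using (0ℓ)
open import Relation.Binary.Core using (Rel)
open import Relation.Binary.Construct.Closure.ReflexiveTransitive using (Star)
open import Relation.Binary.Definitions using (Decidable; Irreflexive; Symmetric)
open import Relation.Binary.PropositionalEquality using (_≡_; _≢_; sym)
open import Relation.Nullary using (¬_; does; ¬?; _×-dec_)

-- Finite simple graphs with vertex set Fin n.  Decidability of adjacency is
-- part of the structure, so that neighbourhoods are elements of Subset n.
record Graph (n : ℕ) : Set₁ where
  infix 4 _~_ _~?_
  field
    _~_      : Rel (Fin n) 0ℓ
    ~-sym    : Symmetric _~_
    ~-irrefl : Irreflexive _≡_ _~_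
    _~?_     : Decidable _~_

  N : Fin n → Subset n
  N u = tabulate (λ w → does (u ~? w))

complement : ∀ {n} → Graph n → Graph n
complement G = record
  { _~_      = λ u w → u ≢ w × ¬ (u ~ w)
  ; ~-sym    = λ (u≢w , u≁w) → u≢w ∘ sym , u≁w ∘ ~-sym
  ; ~-irrefl = λ u≡w (u≢w , _) → u≢w u≡w
  ; _~?_     = λ u w → ¬? (u ≟ w) ×-dec ¬? (u ~? w)
  }
  where open Graph G

Connected : ∀ {n} → Graph n → Set
Connected G = ∀ u w → Star (Graph._~_ G) u w

record IsSRG (v k λ′ μ : ℕ) (G : Graph v) : Set where
  open Graph G
  field
    regular     : ∀ u → ∣ N u ∣ ≡ k
    adjacent    : ∀ {u w} → u ~ w → ∣ N u ∩ N w ∣ ≡ λ′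
    nonadjacent : ∀ {u w} → u ≢ w → ¬ (u ~ w) → ∣ N u ∩ N w ∣ ≡ μ

-- The graphs on zero and one vertices satisfy both connectedness conditions
-- but are by convention not primitive; hence the bound on n.
record Primitive {n : ℕ} (G : Graph n) : Set where
  field
    2≤n                  : 2 ≤ n
    connected            : Connected G
    complement-connected : Connected (complement G)

Shattered : ∀ {n} → Graph n → Subset n → Set
Shattered G S = ∀ A → A ⊆ S → ∃[ u ] N u ∩ S ≡ A
  where open Graph G

-- The VC-dimension as a relation: d is the maximum size of a shattered set.
-- No d is related to the graph without vertices, where not even the empty
-- set is shattered.
record IsVCDimension {n : ℕ} (G : Graph n) (d : ℕ) : Set where
  field
    attained : ∃[ S ] Shattered G S × ∣ S ∣ ≡ d
    maximal  : ∀ S → Shattered G S → ∣ S ∣ ≤ d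

{-# OPTIONS --safe #-}
-- Take distinct nonadjacent vertices x and y, an edge of the complement.  They
-- form a shattered pair: x itself is adjacent to neither of them.  If they had
-- no common neighbour, then μ = 0 and "equal or adjacent" would be transitive,
-- so connectedness would make x and y adjacent.  If N x ⊆ N y, then μ = k, so
-- neighbourhoods grow along the edges of the complement, and connectedness of
-- the complement would make all of them equal, so that G would have no edge.
module Submission where

open import Defs
open import Data.Bool.Properties using () renaming (_≟_ to _≟ᵇ_)
open import Data.Fin.Base using (Fin; zero; suc)
open import Data.Fin.Properties using (_≟_; any?)
open import Data.Fin.Subset
  using (Subset; Empty; _∈_; _∉_; _⊆_; _⊈_; _∩_; _∪_; _-_; ∣_∣; ⁅_⁆)
open import Data.Fin.Subset.Properties
open import Data.Nat.Base using (ℕ; zero; suc; _≤_; _<_; _+_; s≤s)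
open import Data.Nat.Properties
  using ( ≤-refl; ≤-reflexive; ≤-trans; <⇒≤; <-irrefl; ≮⇒≥; m≤m+n; +-suc; +-monoʳ-≤
        ; _<?_)
open import Data.Product.Base using (_×_; _,_; proj₁; proj₂; ∃-syntax)
open import Data.Sum.Base using (_⊎_; inj₁; inj₂; [_,_]′)
open import Data.Vec.Properties using (lookup∘tabulate; lookup⇒[]=; []=⇒lookup; ≡-dec)
open import Function.Base using (_∘_; case_of_; const; flip; id)
open import Level using (Level)
open import Relation.Binary.Construct.Closure.ReflexiveTransitive using (_◅_; fold)
open import Relation.Binary.PropositionalEquality
  using (_≡_; _≢_; refl; sym; trans; cong; subst)
open import Relation.Nullary using (¬_; Dec; yes; no; contradiction; ¬?; _×-dec_)
open import Relation.Nullary.Decidable using (dec-true; map′; decidable-stable; _→-dec_)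
open import Relation.Unary using (Pred; Decidable)

private variable
  ℓ : Level
  n : ℕ
  p q : Subset n

⊈⇒∃∈∉ : p ⊈ q → ∃[ x ] x ∈ p × x ∉ q
⊈⇒∃∈∉ {p = p} {q} p⊈q with any? (λ x → (x ∈? p) ×-dec ¬? (x ∈? q))
... | yes found = found
... | no  none  = contradiction
  (λ {x} x∈p → decidable-stable (x ∈? q) λ x∉q → none (x , x∈p , x∉q)) p⊈q

-- An element of `p` outside `q` would make `p ∩ q` a proper subset of `p`, hence strictly smaller.
∣p∩q∣≡∣p∣⇒p⊆q : ∀ (p q : Subset n) → ∣ p ∩ q ∣ ≡ ∣ p ∣ → p ⊆ q
∣p∩q∣≡∣p∣⇒p⊆q p q eq {x} x∈p = decidable-stable (x ∈? q) λ x∉q →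
  <-irrefl eq (p⊂q⇒∣p∣<∣q∣
    (p∩q⊆p p q , x , x∈p , x∉q ∘ proj₂ ∘ x∈p∩q⁻ p q))

p⊆q⇒p∩q≡p : ∀ (p q : Subset n) → p ⊆ q → p ∩ q ≡ p
p⊆q⇒p∩q≡p p q p⊆q = ⊆-antisym (p∩q⊆p p q) λ x∈p → x∈p∩q⁺ (x∈p , p⊆q x∈p)

∣p∣≡0⇒Empty : ∣ p ∣ ≡ 0 → Empty p
∣p∣≡0⇒Empty {p = p} ∣p∣≡0 (x , x∈p) =
  case subst (∣ p - x ∣ <_) ∣p∣≡0 (x∈p⇒∣p-x∣<∣p∣ x∈p) of λ ()

1<∣⁅x⁆∪⁅y⁆∣ : ∀ {x y : Fin n} → x ≢ y → 1 < ∣ ⁅ x ⁆ ∪ ⁅ y ⁆ ∣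
1<∣⁅x⁆∪⁅y⁆∣ {x = x} {y} x≢y = subst (_< ∣ ⁅ x ⁆ ∪ ⁅ y ⁆ ∣) (∣⁅x⁆∣≡1 x)
  (p⊂q⇒∣p∣<∣q∣ ( p⊆p∪q ⁅ y ⁆ , y , q⊆p∪q ⁅ x ⁆ ⁅ y ⁆ (x∈⁅x⁆ y)
                , x≢y ∘ sym ∘ x∈⁅y⁆⇒x≡y x))

allSubset? : ∀ {P : Pred (Subset n) ℓ} → Decidable P → Dec (∀ p → P p)
allSubset? P? = map′
  (λ ¬∃¬P p → decidable-stable (P? p) λ ¬Pp → ¬∃¬P (p , ¬Pp))
  (λ ∀P (p , ¬Pp) → ¬Pp (∀P p))
  (¬? (anySubset? (¬? ∘ P?)))

-- As long as some strictly larger set satisfies `P`, move on to it; sizes are bounded by `n`, so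
-- this stops at a set of maximum size, no smaller than the starting one. Applied to shattering, it
-- produces the VC-dimension.
maximum : ∀ {P : Pred (Subset n) ℓ} → Decidable P → ∀ p → P p →
          ∃[ m ] P m × ∣ p ∣ ≤ ∣ m ∣ × (∀ q → P q → ∣ q ∣ ≤ ∣ m ∣)
maximum {n = n} {P = P} P? p Pp = search n p Pp (m≤m+n n ∣ p ∣)
  where
  -- Each move spends one unit of fuel and gains at least one element, which preserves
  -- `n ≤ fuel + ∣ p ∣`; when the fuel runs out, `p` already has full size.
  search : ∀ fuel p → P p → n ≤ fuel + ∣ p ∣ →
           ∃[ m ] P m × ∣ p ∣ ≤ ∣ m ∣ × (∀ q → P q → ∣ q ∣ ≤ ∣ m ∣)
  search zero       p Pp n≤∣p∣ = p , Pp , ≤-refl , λ q _ → ≤-trans (∣p∣≤n q) n≤∣p∣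
  search (suc fuel) p Pp n≤ with anySubset? (λ q → P? q ×-dec (∣ p ∣ <? ∣ q ∣))
  ... | no  none           = p , Pp , ≤-refl , λ q Pq → ≮⇒≥ λ p<q → none (q , Pq , p<q)
  ... | yes (q , Pq , p<q) =
    let m , Pm , q≤m , max = search fuel q Pq (≤-trans n≤
          (≤-trans (≤-reflexive (sym (+-suc fuel ∣ p ∣))) (+-monoʳ-≤ fuel p<q)))
    in m , Pm , ≤-trans (<⇒≤ p<q) q≤m , max

-- A path between two distinct vertices is not empty, and its first step is an edge. This serves
-- both the graph and its complement.
connected⇒edge : ∀ (G : Graph n) → 2 ≤ n → Connected G → ∃[ u ] ∃[ w ] Graph._~_ G u w
connected⇒edge G (s≤s (s≤s _)) conn with conn zero (suc zero)
... | u~w ◅ _ = _ , _ , u~w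

module _ (G : Graph n) where
  open Graph G

  ~⇒∈N : ∀ {u w} → u ~ w → w ∈ N u
  ~⇒∈N {u} {w} u~w = lookup⇒[]= w (N u)
    (trans (lookup∘tabulate _ w) (dec-true (u ~? w) u~w))

  ∈N⇒~ : ∀ {u w} → w ∈ N u → u ~ w
  ∈N⇒~ {u} {w} w∈Nu with u ~? w | trans (sym (lookup∘tabulate _ w)) ([]=⇒lookup w∈Nu)
  ... | yes u~w | _  = u~w
  ... | no  _   | ()

  shattered? : Decidable (Shattered G)
  shattered? S = allSubset? λ A → (A ⊆? S) →-dec any? λ u → ≡-dec _≟ᵇ_ (N u ∩ S) A

  -- A subset of the pair is determined by whether it contains `x` and whether it contains `y`; the
  -- hypotheses supply one vertex for each of the four cases.
  shattered-pair : ∀ x y →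
    (∃[ u ] u ~ x × u ~ y) → (∃[ u ] u ~ x × ¬ u ~ y) →
    (∃[ u ] ¬ u ~ x × u ~ y) → (∃[ u ] ¬ u ~ x × ¬ u ~ y) →
    Shattered G (⁅ x ⁆ ∪ ⁅ y ⁆)
  shattered-pair x y (a , a~x , a~y) (b , b~x , b≁y) (c , c≁x , c~y) (d , d≁x , d≁y) A A⊆S =
    realise (x ∈? A) (y ∈? A)
    where
    -- Both sides lie inside the pair, so they need comparing only at `x` and at `y`.
    trace : ∀ u → (u ~ x → x ∈ A) → (x ∈ A → u ~ x) →
            (u ~ y → y ∈ A) → (y ∈ A → u ~ y) → N u ∩ (⁅ x ⁆ ∪ ⁅ y ⁆) ≡ A
    trace u x⇒ x⇐ y⇒ y⇐ = ⊆-antisym ⊆A A⊆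
      where
      ⊆A : N u ∩ (⁅ x ⁆ ∪ ⁅ y ⁆) ⊆ A
      ⊆A z∈ with x∈p∩q⁻ (N u) _ z∈
      ... | z∈N , z∈S with x∈p∪q⁻ ⁅ x ⁆ ⁅ y ⁆ z∈S
      ... | inj₁ z∈⁅x⁆ with refl ← x∈⁅y⁆⇒x≡y x z∈⁅x⁆ = x⇒ (∈N⇒~ z∈N)
      ... | inj₂ z∈⁅y⁆ with refl ← x∈⁅y⁆⇒x≡y y z∈⁅y⁆ = y⇒ (∈N⇒~ z∈N)
      A⊆ : A ⊆ N u ∩ (⁅ x ⁆ ∪ ⁅ y ⁆)
      A⊆ z∈A with x∈p∪q⁻ ⁅ x ⁆ ⁅ y ⁆ (A⊆S z∈A)
      ... | inj₁ z∈⁅x⁆ with refl ← x∈⁅y⁆⇒x≡y x z∈⁅x⁆ = x∈p∩q⁺ (~⇒∈N (x⇐ z∈A) , A⊆S z∈A)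
      ... | inj₂ z∈⁅y⁆ with refl ← x∈⁅y⁆⇒x≡y y z∈⁅y⁆ = x∈p∩q⁺ (~⇒∈N (y⇐ z∈A) , A⊆S z∈A)

    realise : Dec (x ∈ A) → Dec (y ∈ A) → ∃[ u ] N u ∩ (⁅ x ⁆ ∪ ⁅ y ⁆) ≡ A
    realise (yes x∈A) (yes y∈A) = a , trace a (const x∈A) (const a~x) (const y∈A) (const a~y)
    realise (yes x∈A) (no  y∉A) = b , trace b (const x∈A) (const b~x)
                                          (flip contradiction b≁y) (flip contradiction y∉A)
    realise (no  x∉A) (yes y∈A) = c , trace c (flip contradiction c≁x)
                                          (flip contradiction x∉A) (const y∈A) (const c~y)
    realise (no  x∉A) (no  y∉A) = d , trace d (flip contradiction d≁x) (flip contradiction x∉A)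
                                          (flip contradiction d≁y) (flip contradiction y∉A)

module _ {v k λ′ μ : ℕ} {G : Graph v} (srg : IsSRG v k λ′ μ G) where
  open Graph G
  open IsSRG srg
  open Graph (complement G) using () renaming (_~_ to _≁_)

  common-neighbour : Connected G → ∀ {x y} → x ≁ y → ∃[ u ] u ~ x × u ~ y
  common-neighbour conn {x} {y} (x≢y , ¬x~y) with nonempty? (N x ∩ N y)
  ... | yes (u , u∈) =
    let u∈Nx , u∈Ny = x∈p∩q⁻ (N x) (N y) u∈
    in u , ~-sym (∈N⇒~ G u∈Nx) , ~-sym (∈N⇒~ G u∈Ny)
  -- Folding along a path from `x` to `y` makes them equal or adjacent, and both are excluded.
  ... | no none = contradiction (fold _≡⊎~_ extend (inj₁ refl) (conn x y)) [ x≢y , ¬x~y ]′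
    where
    _≡⊎~_ : Fin v → Fin v → Set
    u ≡⊎~ w = u ≡ w ⊎ u ~ w

    μ≡0 : μ ≡ 0
    μ≡0 = trans (sym (nonadjacent x≢y ¬x~y))
                (trans (cong ∣_∣ (Empty-unique none)) (∣⊥∣≡0 v))

    extend : ∀ {u w z} → u ~ w → w ≡⊎~ z → u ≡⊎~ z
    extend u~w (inj₁ refl) = inj₂ u~w
    extend {u} {w} {z} u~w (inj₂ w~z) with u ≟ z | u ~? z
    ... | yes u≡z | _        = inj₁ u≡z
    ... | no  _   | yes u~z  = inj₂ u~z
    -- Here `w` is a common neighbour of two distinct nonadjacent vertices, against `μ ≡ 0`.
    ... | no  u≢z | no ¬u~z  = contradiction
      (w , x∈p∩q⁺ (~⇒∈N G u~w , ~⇒∈N G (~-sym w~z)))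
      (∣p∣≡0⇒Empty (trans (nonadjacent u≢z ¬u~z) μ≡0))

  private-neighbour : Primitive G → ∀ {x y} → x ≁ y → ∃[ u ] u ~ x × ¬ u ~ y
  private-neighbour prim {x} {y} (x≢y , ¬x~y) =
    let u , u∈Nx , u∉Ny = ⊈⇒∃∈∉ Nx⊈Ny
    in u , ~-sym (∈N⇒~ G u∈Nx) , u∉Ny ∘ ~⇒∈N G ∘ ~-sym
    where
    open Primitive prim

    Nx⊈Ny : N x ⊈ N y
    Nx⊈Ny Nx⊆Ny =
      -- A complement path from `u` to `w` gives `N u ⊆ N w`; since `w ∈ N u`, the vertex `w` would
      -- be its own neighbour.
      let u , w , u~w = connected⇒edge G 2≤n connected
          Nu⊆Nw = fold (λ u w → N u ⊆ N w) (λ u≁w Nw⊆ → Nw⊆ ∘ grow u≁w) id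
                    (complement-connected u w)
      in ~-irrefl refl (∈N⇒~ G (Nu⊆Nw (~⇒∈N G u~w)))
      where
      μ≡k : μ ≡ k
      μ≡k = trans (sym (nonadjacent x≢y ¬x~y))
                  (trans (cong ∣_∣ (p⊆q⇒p∩q≡p (N x) (N y) Nx⊆Ny)) (regular x))

      -- The intersection `N u ∩ N w` has `μ` elements, which is `k`, the size of all of `N u`.
      grow : ∀ {u w} → u ≁ w → N u ⊆ N w
      grow {u} {w} (u≢w , ¬u~w) = ∣p∩q∣≡∣p∣⇒p⊆q (N u) (N w)
        (trans (nonadjacent u≢w ¬u~w) (trans μ≡k (sym (regular u))))

  complement-edge-shattered : Primitive G → ∀ {x y} → x ≁ y → Shattered G (⁅ x ⁆ ∪ ⁅ y ⁆)
  complement-edge-shattered prim {x} {y} x≁y =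
    let u , u~y , ¬u~x = private-neighbour prim (Graph.~-sym (complement G) x≁y)
    in shattered-pair G x y
         (common-neighbour (Primitive.connected prim) x≁y)
         (private-neighbour prim x≁y)
         (u , ¬u~x , u~y)
         (x , ~-irrefl refl , proj₂ x≁y)

proposition22 : ∀ (v k λ′ μ : ℕ) (G : Graph v) →
    IsSRG v k λ′ μ G → Primitive G →
    ∃[ d ] IsVCDimension G d × 2 ≤ d
proposition22 v k λ′ μ G srg prim =
  let open Primitive prim
      x , y , x≁y = connected⇒edge (complement G) 2≤n complement-connected
      -- Starting the search at the shattered pair ensures that the maximum is at least its size.
      S , shattered , pair≤S , maximal =
        maximum (shattered? G) (⁅ x ⁆ ∪ ⁅ y ⁆) (complement-edge-shattered srg prim x≁y)
  in ∣ S ∣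
   , record { attained = S , shattered , refl ; maximal = maximal }
   , ≤-trans (1<∣⁅x⁆∪⁅y⁆∣ (proj₁ x≁y)) pair≤S
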